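{- Let $R:=(E,\rho,F)$ and $R':=(E',\rho',F')$ be two incidence structures. If $R$ has a coding into $R'$, then there exist an (order) embedding $\phi$ from $\overline{Gal(R)}$ into $\overline{Gal(R')}$ and a continuous and order-preserving map $\psi$ from a closed subspace $\mathcal{H}$ of $\overline{Gal(R')}$ onto $\overline{Gal(R)}$ such that $\psi\circ\phi$ is the identity map of $\overline{Gal(R)}$ (with $\phi$ taking its values in $\mathcal{H}$).
   Context: An incidence structure is a triple $R=(E,\rho,F)$ with $E,F$ sets and $\rho\subseteq E\times F$. For $Y\subseteq F$, $L_R(Y):=\{x\in E: x\rho y \text{ for all } y\in Y\}$. The Galois lattice of $R$ is $Gal(R):=\{L_R(Y): Y\subseteq F\}$, ordered by inclusion. A coding from $R=(E,\rho,F)$ into $R'=(E',\rho',F')$ is a pair of maps $f:E\to E'$, $g:F\to F'$ such that $x\rho y\iff f(x)\rho' g(y)$ for all $x\in E$, $y\in F$. The power set $\mathfrak{P}(E)$ is identified with $2^E$ with the product topology ($2$ discrete); $\overline{Gal(R)}$ denotes the topological closure of $Gal(R)$ in $\mathfrak{P}(E)$ (and similarly $\overline{Gal(R')}$ in $\mathfrak{P}(E')$), with the induced topology and ordered by inclusion. -}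

module Defs where

open import Level using (Level; _⊔_; suc)
open import Data.List.Base using (List)
open import Data.List.Relation.Unary.All using (All)
open import Data.Product.Base using (∃; ∃-syntax; Σ-syntax; _×_; proj₁)
open import Function.Bundles using (_⇔_)
open import Relation.Binary.Core using (Rel; REL)
open import Relation.Unary using (Pred; _∈_; _⊆_; _≐_; _∩_; ∁)

private
  variable
    ℓ s t : Level

record IncidenceStructure (ℓ : Level) : Set (suc ℓ) where
  field
    E F : Set ℓ
    ρ   : REL E F ℓ

record Coding (R R′ : IncidenceStructure ℓ) : Set ℓ where
  private
    module R  = IncidenceStructure R
    module R′ = IncidenceStructure R′
  field
    f   : R.E → R′.E
    g   : R.F → R′.F
    ρ⇔ρ′ : ∀ x y → R.ρ x y ⇔ R′.ρ (f x) (g y)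

-- Subsets are predicates, and equality of subsets is extensional equality _≐_.
𝔓 : Set ℓ → Set (suc ℓ)
𝔓 {ℓ} E = Pred E ℓ

module _ (R : IncidenceStructure ℓ) where
  open IncidenceStructure R

  L : 𝔓 F → 𝔓 E
  L Y x = ∀ y → y ∈ Y → ρ x y

  Gal : Pred (𝔓 E) (suc ℓ)
  Gal X = ∃[ Y ] X ≐ L Y

module _ {E : Set ℓ} where

  Agree : List E → Rel (𝔓 E) ℓ
  Agree A X Z = All (λ x → x ∈ X ⇔ x ∈ Z) A

  -- Product topology on 2^E, with 2 discrete: the sets { Z | Agree A X Z }
  -- with A finite are a neighbourhood base at X.
  Open : Pred (𝔓 E) s → Set (suc ℓ ⊔ s)
  Open U = ∀ {X} → X ∈ U → ∃[ A ] (∀ {Z} → Agree A X Z → Z ∈ U)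

  Closed : Pred (𝔓 E) s → Set (suc ℓ ⊔ s)
  Closed C = Open (∁ C)

  -- Here and in Continuous it is enough to let open sets range over
  -- Pred (𝔓 E) ℓ, because the basic open sets above live at this level.
  Closure : Pred (𝔓 E) s → Pred (𝔓 E) (suc ℓ ⊔ s)
  Closure S X = ∀ (U : Pred (𝔓 E) ℓ) → Open U → X ∈ U → ∃[ Z ] Z ∈ S × Z ∈ U

  ClosedIn : Pred (𝔓 E) (suc ℓ) → Pred (𝔓 E) (suc ℓ) → Set (suc (suc ℓ))
  ClosedIn T H = Σ[ C ∈ Pred (𝔓 E) (suc ℓ) ] Closed C × H ≐ (T ∩ C)

  -- A family S of subsets, regarded as the space ∃ S, ordered by inclusion.
  module _ {S : Pred (𝔓 E) s} where

    infix 4 _≋_ _⊑_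

    _≋_ : Rel (∃ S) ℓ
    X ≋ Z = proj₁ X ≐ proj₁ Z

    _⊑_ : Rel (∃ S) ℓ
    X ⊑ Z = proj₁ X ⊆ proj₁ Z

-- The open sets of a subspace ∃ S are the traces of the open sets of 𝔓 E.
Continuous : {E E′ : Set ℓ} {S : Pred (𝔓 E) s} {T : Pred (𝔓 E′) t} →
             (∃ S → ∃ T) → Set (suc ℓ ⊔ s)
Continuous {ℓ = ℓ} {E = E} {E′ = E′} {S = S} h =
  ∀ (V : Pred (𝔓 E′) ℓ) → Open V →
  Σ[ U ∈ Pred (𝔓 E) ℓ ] Open U × (∀ (X : ∃ S) → proj₁ (h X) ∈ V ⇔ proj₁ X ∈ U)

{-# OPTIONS --safe #-}

-- The closure of Gal(R) consists of the sets X that contain, with every finite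
-- set A, the least member L{ y | A ⊆ L{y} } of Gal(R) above A: it is the lattice
-- of closed sets of a finitary closure operator. Inverse image under f is
-- continuous and order-preserving, and ψ is its restriction to those members of
-- the closure of Gal(R′) that it sends into the closure of Gal(R). The map φ
-- sends X to the set generated by f(X) under the closure operator of R′; since
-- (f , g) is a coding, f x is generated by f(A) only if x is generated by A,
-- whence ψ ∘ φ = id.

module Submission where

open import Defs
open import Axiom.ExcludedMiddle using (ExcludedMiddle)
open import Data.List.Base using (List; []; _∷_; _++_; filter; map)
open import Data.List.Membership.Propositional.Properties using (∈-filter⁺)
open import Data.List.Relation.Unary.All as All using (All; []; _∷_; lookup; tabulate; zipWith)
open import Data.List.Relation.Unary.All.Properties using (all-filter; map⁺; map⁻; ++⁺; ++⁻ˡ; ++⁻ʳ)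
open import Data.Product.Base using (∃; ∃-syntax; Σ-syntax; _×_; _,_; proj₁; proj₂)
open import Function.Base using (id; _∘_)
open import Function.Bundles using (Equivalence; mk⇔)
open import Function.Construct.Composition using (_⇔-∘_)
open import Function.Construct.Identity using (⇔-id)
open import Function.Definitions using (Surjective)
open import Level using (Level; suc; Lift; lift; lower)
open import Relation.Binary.Definitions using (Transitive)
open import Relation.Binary.Morphism.Structures using (IsOrderHomomorphism; IsOrderMonomorphism)
open import Relation.Nullary.Decidable using (decidable-stable; map′)
open import Relation.Nullary using (¬_; yes; no; contradiction)
open import Relation.Binary.PropositionalEquality using (_≡_; refl; cong)
open import Relation.Unary using (Pred; _∈_; _⊆_; _≐_; _∩_; _⊢_)
open import Relation.Unary.Properties using (≐-sym)

open Equivalence using (to; from)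

private
  variable
    ℓ s : Level

lowerEM : ExcludedMiddle (suc ℓ) → ExcludedMiddle ℓ
lowerEM {ℓ} em {P} = map′ lower lift (em {Lift (suc ℓ) P})

module _ {E : Set ℓ} where

  Agree-trans : ∀ {A : List E} → Transitive (Agree A)
  Agree-trans p q = zipWith (λ (u , v) → v ⇔-∘ u) (p , q)

  Agree-open : ∀ (A : List E) X → Open (Agree A X)
  Agree-open A X p = A , Agree-trans p

  Closure-resp-≐ : {S : Pred (𝔓 E) s} {X Z : 𝔓 E} → X ≐ Z → X ∈ Closure S → Z ∈ Closure S
  Closure-resp-≐ (X⊆Z , Z⊆X) X∈ U U-open Z∈U =
    let A , near = U-open Z∈U in
    X∈ U U-open (near (tabulate λ _ → mk⇔ Z⊆X X⊆Z))

  -- A point outside the closure has an open neighbourhood missing `S`, which excludes all its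
  -- points from the closure. Excluded middle extracts it, at level `suc ℓ` because neighbourhoods
  -- are predicates on `𝔓 E`.
  Closure-closed : ExcludedMiddle (suc ℓ) → (S : Pred (𝔓 E) (suc ℓ)) → Closed (Closure S)
  Closure-closed em S {X} X∉
    with em {Σ[ U ∈ Pred (𝔓 E) ℓ ] Open U × X ∈ U × ¬ (∃[ Z ] Z ∈ S × Z ∈ U)}
  ... | yes (U , U-open , X∈U , U∩S=∅) =
    let A , near = U-open X∈U in A , λ A⇔ Z∈ → U∩S=∅ (Z∈ U U-open (near A⇔))
  ... | no ¬separated = contradiction
    (λ U (U-open : Open U) X∈U → decidable-stable em (λ U∩S=∅ → ¬separated (U , (λ {_} → U-open) , X∈U , U∩S=∅))) X∉

module _ {E E′ : Set ℓ} (f : E → E′) where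

  preimage-open : {V : Pred (𝔓 E) s} → Open V → Open (λ Z → (f ⊢ Z) ∈ V)
  preimage-open V-open Z∈ = let A , near = V-open Z∈ in map f A , near ∘ map⁻

module _ (R : IncidenceStructure ℓ) where
  open IncidenceStructure R

  span : List E → 𝔓 E
  span A = L R (λ y → All (λ a → ρ a y) A)

  FinitelyClosed : Pred (𝔓 E) ℓ
  FinitelyClosed X = ∀ {A} → All (_∈ X) A → span A ⊆ X

  -- Some `L R Y` agrees with `X` on `b ∷ A`. As it contains `A`, each `y ∈ Y` is related to all of
  -- `A`, hence to `b`.
  Closure-Gal⇒FinitelyClosed : Closure (Gal R) ⊆ FinitelyClosed
  Closure-Gal⇒FinitelyClosed {X} X∈ {A} A⊆X {b} b∈span
    with X∈ (Agree (b ∷ A) X) (Agree-open (b ∷ A) X) (tabulate (λ _ → ⇔-id _))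
  ... | Z , (Y , Z⊆LY , LY⊆Z) , (b⇔ ∷ A⇔) =
    from b⇔ (LY⊆Z λ y y∈Y → b∈span y (zipWith (λ (a⇔ , a∈X) → Z⊆LY (to a⇔ a∈X) y y∈Y) (A⇔ , A⊆X)))

  FinitelyClosed⇒Closure-Gal : ExcludedMiddle ℓ → FinitelyClosed ⊆ Closure (Gal R)
  FinitelyClosed⇒Closure-Gal em {X} closed U U-open X∈U =
    span A⁺ , (_ , id , id) , near agree
    where
    A    = proj₁ (U-open X∈U)
    near = proj₂ (U-open X∈U)
    X?   = λ x → em {x ∈ X}
    -- The trace of `X` on the finite set that defines the neighbourhood; its span contains this
    -- trace and stays inside `X`.
    A⁺   = filter X? A
    agree : Agree A X (span A⁺)
    agree = tabulate λ x∈A → mk⇔ (λ x∈X y A⁺ρy → lookup A⁺ρy (∈-filter⁺ X? x∈A x∈X))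
                                 (closed (all-filter X? A))

  -- The directed union of the spans of the finite subsets of `S`.
  Generated : 𝔓 E → 𝔓 E
  Generated S b = ∃[ A ] All (_∈ S) A × b ∈ span A

  Generated-closed : ∀ S → FinitelyClosed (Generated S)
  Generated-closed S B⊆ c∈ = let A , A⊆S , le = collect B⊆ in A , A⊆S , λ y Aρy → c∈ y (le y Aρy)
    where
    -- The finitely many finite supports of the members of `B` concatenate into a single one.
    collect : ∀ {B} → All (_∈ Generated S) B →
              ∃[ A ] All (_∈ S) A × (∀ y → All (λ a → ρ a y) A → All (λ b → ρ b y) B)
    collect [] = [] , [] , λ _ _ → []
    collect ((A , A⊆S , b∈) ∷ B⊆) =
      let A′ , A′⊆S , le = collect B⊆ in
      A ++ A′ , ++⁺ A⊆S A′⊆S , λ y p → b∈ y (++⁻ˡ A p) ∷ le y (++⁻ʳ A p)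

  Generated-mono : ∀ {S T} → S ⊆ T → Generated S ⊆ Generated T
  Generated-mono S⊆T (A , A⊆S , b∈) = A , All.map S⊆T A⊆S , b∈

  ⊆Generated : ∀ S → S ⊆ Generated S
  ⊆Generated S {x} x∈S = x ∷ [] , x∈S ∷ [] , λ { _ (xρy ∷ _) → xρy }

module _ {R R′ : IncidenceStructure ℓ} (c : Coding R R′) where
  open IncidenceStructure
  open Coding c

  image : 𝔓 (E R) → 𝔓 (E R′)
  image X x′ = ∃[ x ] x ∈ X × f x ≡ x′

  -- It suffices to test `f x` against the elements `g y`, where the coding translates both ways.
  preimage-span : ∀ A → f ⊢ span R′ (map f A) ⊆ span R A
  preimage-span A {x} fx∈ y Aρy =
    from (ρ⇔ρ′ x y) (fx∈ (g y) (map⁺ (All.map (to (ρ⇔ρ′ _ y)) Aρy)))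

  image-list : ∀ {X A′} → All (_∈ image X) A′ → ∃[ A ] All (_∈ X) A × A′ ≡ map f A
  image-list [] = [] , [] , refl
  image-list ((x , x∈X , refl) ∷ A′⊆) =
    let A , A⊆X , A′≡ = image-list A′⊆ in x ∷ A , x∈X ∷ A⊆X , cong (f x ∷_) A′≡

  preimage-Generated : ∀ {X} → FinitelyClosed R X → f ⊢ Generated R′ (image X) ≐ X
  preimage-Generated {X} X-closed = ⊆X , λ x∈X → ⊆Generated R′ (image X) (_ , x∈X , refl)
    where
    ⊆X : f ⊢ Generated R′ (image X) ⊆ X
    ⊆X (A′ , A′⊆ , fx∈) with image-list A′⊆
    ... | A , A⊆X , refl = X-closed A⊆X (preimage-span A fx∈)

theorem7 : ∀ {ℓ : Level} → ExcludedMiddle (suc ℓ) →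
    (R R′ : IncidenceStructure ℓ) → Coding R R′ →
    Σ[ φ ∈ (∃ (Closure (Gal R)) → ∃ (Closure (Gal R′))) ]
    Σ[ H ∈ Pred (𝔓 (IncidenceStructure.E R′)) (suc ℓ) ]
    Σ[ ψ ∈ (∃ H → ∃ (Closure (Gal R))) ]
    IsOrderMonomorphism _≋_ _≋_ _⊑_ _⊑_ φ ×
    ClosedIn (Closure (Gal R′)) H ×
    Continuous ψ ×
    IsOrderHomomorphism _≋_ _≋_ _⊑_ _⊑_ ψ ×
    Surjective _≋_ _≋_ ψ ×
    (Σ[ φ∈H ∈ (∀ X → proj₁ (φ X) ∈ H) ]
    (∀ X → ψ (proj₁ (φ X) , φ∈H X) ≋ X))
theorem7 {ℓ} em R R′ c =
  φ , H , ψ , φ-mono ,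
  -- The complement of `C` is the inverse image of the complement of a closed set.
  (C , preimage-open f (Closure-closed em (Gal R)) , id , id) ,
  (λ V V-open → _ , preimage-open f V-open , λ _ → ⇔-id _) ,
  record { cong = λ (Z⊆W , W⊆Z) → (λ {_} → Z⊆W) , λ {_} → W⊆Z ; mono = λ Z⊆W {_} → Z⊆W } ,
  -- Surjectivity up to `_≋_` asks that every `Z ≋ φ X` in `H` be sent to `X`, not only `φ X`
  -- itself.
  (λ X → (proj₁ (φ X) , φ∈H X) ,
    λ (Z⊆ , ⊆Z) → (λ {_} → proj₁ (f⊢φ≐ X) ∘ Z⊆) , λ {_} → ⊆Z ∘ proj₂ (f⊢φ≐ X)) ,
  φ∈H , f⊢φ≐
  where
  open Coding c using (f)

  φ : ∃ (Closure (Gal R)) → ∃ (Closure (Gal R′))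
  φ (X , _) = Generated R′ (image c X) ,
    FinitelyClosed⇒Closure-Gal R′ (lowerEM em) (Generated-closed R′ (image c X))

  C H : Pred (𝔓 (IncidenceStructure.E R′)) (suc ℓ)
  C Z = (f ⊢ Z) ∈ Closure (Gal R)
  H = Closure (Gal R′) ∩ C

  ψ : ∃ H → ∃ (Closure (Gal R))
  ψ (Z , _ , fZ∈) = f ⊢ Z , fZ∈

  f⊢φ≐ : ∀ X → f ⊢ proj₁ (φ X) ≐ proj₁ X
  f⊢φ≐ (X , X∈) = preimage-Generated c (Closure-Gal⇒FinitelyClosed R X∈)

  φ∈H : ∀ X → proj₁ (φ X) ∈ H
  φ∈H X = proj₂ (φ X) , Closure-resp-≐ (≐-sym (f⊢φ≐ X)) (proj₂ X)

  φ-⊑ : ∀ {X Y} → X ⊑ Y → φ X ⊑ φ Y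
  φ-⊑ X⊆Y = Generated-mono R′ (λ (x , x∈X , fx≡) → x , X⊆Y x∈X , fx≡)

  φ-cancel : ∀ {X Y} → φ X ⊑ φ Y → X ⊑ Y
  -- Inverse image under `f` is monotone and recovers `X` and `Y`.
  φ-cancel {X} {Y} φX⊆φY = proj₁ (f⊢φ≐ Y) ∘ φX⊆φY ∘ proj₂ (f⊢φ≐ X)

  φ-mono : IsOrderMonomorphism _≋_ _≋_ _⊑_ _⊑_ φ
  φ-mono = record
    { isOrderHomomorphism = record
      { cong = λ {X} {Y} (X⊆Y , Y⊆X) →
          (λ {_} → φ-⊑ {X} {Y} X⊆Y) , λ {_} → φ-⊑ {Y} {X} Y⊆X
      ; mono = λ {X} {Y} → φ-⊑ {X} {Y}
      }
    ; injective = λ {X} {Y} (φX⊆φY , φY⊆φX) →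
        (λ {_} → φ-cancel {X} {Y} φX⊆φY) , λ {_} → φ-cancel {Y} {X} φY⊆φX
    ; cancel = λ {X} {Y} → φ-cancel {X} {Y}
    }
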